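{- Fix integers $k\geq 2$, $a\in\mathbb{Z}$, $0\le s\le r$ with $r\ge 1$, and positive integers $A_1,\dots,A_r$. Let $P(y)=(y-a)^e\prod_{j=1}^t P_j(y)^{e_j}\in\mathbb{Z}[y]$ with $e\geq 1$, $e_j\ge 1$, where $P_1,\dots,P_t\in\mathbb{Z}[y]$ are distinct irreducible polynomials. Then the equation $$P(y)=\prod_{i=1}^s A_i^{n_i}n_i!\cdot\prod_{i=s+1}^r A_i^{n_i}n_i!!$$ has only finitely many solutions $(n_1,\dots,n_r,y)$ with $n_1,\dots,n_r$ positive integers and $y=x+a$ for some $x\in\mathcal{F}_k$.
   Context: For a positive integer $x=\prod_{i\in I}p_i^{\alpha_i}$ (prime factorization), $K(x)=\max_{i\in I}\alpha_i$ (with $K(1)=0$) and $\omega(x)=|I|$ is the number of distinct prime factors. $\mathcal{F}_k=\{x\in\mathbb{N}: K(x)<k\}$ (positive integers all of whose prime exponents are $<k$). $n!!$ is the double factorial. -}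

module Defs where

open import Algebra.Bundles using (RawSemiring)
import Algebra.Definitions.RawSemiring as RawSemiringDefs
open import Data.Fin.Base using (Fin; toℕ)
open import Data.Integer.Base as ℤ using (ℤ)
open import Data.List.Base using (List; []; _∷_; map; filter; length; allFin)
open import Data.List.Extrema.Nat using (max)
open import Data.Nat.Base using (ℕ; zero; suc; _*_; _^_; _<_; NonZero; _!)
open import Data.Nat.ListAction using (product)
open import Data.Nat.Primality.Factorisation using (factorise; factors)
open import Data.Nat.Properties using (_≟_; _<?_; _≤?_)
open import Data.Product.Base using (Σ)
open import Data.Vec.Base using (Vec; lookup)
open import Level using (0ℓ)
open import Relation.Binary.PropositionalEquality.Core using (_≡_)

-- Integer polynomials as coefficient lists, constant term first.  Trailing
-- zeros are allowed, so equality of polynomials is _≈ₚ_ and not _≡_.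

Poly : Set
Poly = List ℤ

coeff : Poly → ℕ → ℤ
coeff []      _       = ℤ.0ℤ
coeff (c ∷ p) zero    = c
coeff (c ∷ p) (suc n) = coeff p n

infix 4 _≈ₚ_
_≈ₚ_ : Poly → Poly → Set
p ≈ₚ q = ∀ n → coeff p n ≡ coeff q n

infixl 6 _+ₚ_
_+ₚ_ : Poly → Poly → Poly
[]      +ₚ q       = q
(c ∷ p) +ₚ []      = c ∷ p
(c ∷ p) +ₚ (d ∷ q) = (c ℤ.+ d) ∷ (p +ₚ q)

infixl 7 _*ₚ_
_*ₚ_ : Poly → Poly → Poly
[]      *ₚ q = []
(c ∷ p) *ₚ q = map (c ℤ.*_) q +ₚ (ℤ.0ℤ ∷ (p *ₚ q))

ℤ[y] : RawSemiring 0ℓ 0ℓ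
ℤ[y] = record
  { Carrier = Poly
  ; _≈_     = _≈ₚ_
  ; _+_     = _+ₚ_
  ; _*_     = _*ₚ_
  ; 0#      = []
  ; 1#      = ℤ.1ℤ ∷ []
  }

-- Irreducible is the ring-theoretic notion in ℤ[y]: a non-unit that is not a
-- product of two non-units (in particular it is not zero).
open RawSemiringDefs ℤ[y] public
  using (Irreducible) renaming (_^_ to _^ₚ_; product to ∏ₚ)

eval : Poly → ℤ → ℤ
eval []      y = ℤ.0ℤ
eval (c ∷ p) y = c ℤ.+ y ℤ.* eval p y

y-_ : ℤ → Poly
y- a = (ℤ.- a) ∷ ℤ.1ℤ ∷ []

-- The list of prime factors contains each prime as often as its exponent.
exponent : ℕ → (x : ℕ) .{{_ : NonZero x}} → ℕ
exponent p x = length (filter (p ≟_) (factors (factorise x)))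

K : (x : ℕ) .{{_ : NonZero x}} → ℕ
K x = max 0 (map (λ p → exponent p x) (factors (factorise x)))

𝓕 : ℕ → ℕ → Set
𝓕 k x = Σ (NonZero x) λ x≢0 → K x {{x≢0}} < k

infix 9 _!!
_!! : ℕ → ℕ
zero        !! = 1
suc zero    !! = 1
suc (suc n) !! = suc (suc n) * n !!

-- Indices are shifted down by one: i : Fin r stands for the index toℕ i + 1,
-- so 1 ≤ index ≤ s reads toℕ i < s, and s + 1 ≤ index ≤ r reads s ≤ toℕ i.
factorialProduct : ∀ {r} → ℕ → (Fin r → ℕ) → Vec ℕ r → ℕ
factorialProduct {r} s A n =
    product (map (λ i → A i ^ lookup n i * lookup n i !)
                 (filter (λ i → toℕ i <? s) (allFin r)))
  * product (map (λ i → A i ^ lookup n i * lookup n i !!)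
                 (filter (λ i → s ≤? toℕ i) (allFin r)))

{-# OPTIONS --safe #-}
-- Let N be the right-hand side, m = maxᵢ nᵢ and R = maxᵢ Aᵢ.  Since e ≥ 1, x
-- divides P(x + a) = N, so every prime factor of x is at most m + R.  As x is
-- k-free, x divides the k-th power of its radical, and the radical is a product
-- of distinct primes ≤ m + R; Chebyshev's bound on central binomial coefficients
-- therefore gives x ≤ 16^(k(m+R)).  Hence m!! ≤ N = P(x + a) is at most
-- exponential in m, which bounds m, and then also x.
module Submission where

open import Defs
import Algebra.Properties.CommutativeSemigroup as CommutativeSemigroupProperties
open import Data.Fin.Base as Fin using (Fin; toℕ)
open import Data.Integer.Base as ℤ using (ℤ; +_; ∣_∣)
import Data.Integer.Properties as ℤ
open import Data.Integer.Solver using (module +-*-Solver)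
open import Data.List.Base using (List; []; _∷_; map; filter; length; allFin; upTo; deduplicate; cartesianProduct; cartesianProductWith)
open import Data.List.Extrema.Nat using (max; argmax; xs≤max; f[xs]≤f[argmax])
open import Data.List.Membership.Propositional using (_∈_)
open import Data.List.Membership.Propositional.Properties using (∈-filter⁺; ∈-filter⁻; ∈-map⁺; ∈-allFin; ∈-upTo⁺; ∈-cartesianProduct⁺; ∈-cartesianProductWith⁺; ∈-deduplicate⁺)
open import Data.List.Properties using (filter-none)
open import Data.List.Relation.Binary.Sublist.Propositional.Properties using (filter⁺; filter-⊆; length-mono-≤)
open import Data.List.Relation.Unary.All as All using (All; []; _∷_)
import Data.List.Relation.Unary.All.Properties as All
open import Data.List.Relation.Unary.AllPairs using ([]; _∷_)
open import Data.List.Relation.Unary.Any using (here; there; any?)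
open import Data.List.Relation.Unary.Unique.Propositional using (Unique)
import Data.List.Relation.Unary.Unique.DecPropositional.Properties as Unique
open import Data.Nat.Base using (ℕ; zero; suc; _+_; _*_; _^_; _∸_; _≤_; _<_; _!; NonZero; nonZero; z≤n; s≤s; >-nonZero)
open import Data.Nat.Combinatorics using (_C_; nCk≡n!/k![n-k]!; nCk+nC[k+1]≡[n+1]C[k+1]; k![n∸k]!∣n!)
open import Data.Nat.Divisibility using (_∣_; divides; ∣-refl; ∣-trans; ∣⇒≤; ∣1⇒≡1; 1∣_; m∣m*n; ∣m⇒∣m*n; ∣n⇒∣m*n; *-monoʳ-∣; m≤n⇒m!∣n!)
open import Data.Nat.DivMod using (m/n*n≡m)
open import Data.Nat.ListAction using (product)
open import Data.Nat.ListAction.Properties using (∈⇒∣product; product≢0)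
open import Data.Nat.Primality using (Prime; euclidsLemma; prime⇒irreducible; prime⇒nonZero; ¬prime[0]; ¬prime[1])
open import Data.Nat.Primality.Factorisation using (factorise; module PrimeFactorisation)
open import Data.Nat.Properties
open import Data.Product.Base using (_×_; _,_; ∃-syntax)
open import Data.Sum.Base as Sum using (_⊎_; inj₁; inj₂)
open import Data.Vec.Base using (Vec; []; _∷_; lookup)
open import Function.Base using (_∘_)
open import Relation.Binary.PropositionalEquality.Core using (_≡_; _≢_; refl; sym; trans; cong; cong₂; subst)
open import Relation.Binary.PropositionalEquality.Properties using (module ≡-Reasoning)
open import Relation.Nullary.Decidable using (yes; no; ¬?)
open import Relation.Nullary.Negation.Core using (¬_; contradiction)
open import Relation.Unary using (Decidable)

open PrimeFactorisation using (factors; isFactorisation; factorsPrime)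
open CommutativeSemigroupProperties *-commutativeSemigroup using (interchange; x∙yz≈y∙xz)

^-distribʳ-* : ∀ k m n → (m * n) ^ k ≡ m ^ k * n ^ k
^-distribʳ-* zero    m n = refl
^-distribʳ-* (suc k) m n =
  trans (cong (λ z → m * n * z) (^-distribʳ-* k m n)) (interchange m n (m ^ k) (n ^ k))

-- Evaluation of polynomials

-- Representatives of one polynomial may differ in trailing zeros; this serves the cases of
-- `eval-cong` in which one list has ended before the other.
eval-≈0 : ∀ p y → (∀ n → coeff p n ≡ ℤ.0ℤ) → eval p y ≡ ℤ.0ℤ
eval-≈0 []      y p≈0 = refl
eval-≈0 (c ∷ p) y p≈0
  rewrite p≈0 0 | eval-≈0 p y (p≈0 ∘ suc) | ℤ.*-zeroʳ y = refl

eval-cong : ∀ p q y → p ≈ₚ q → eval p y ≡ eval q y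
eval-cong []      q       y p≈q = sym (eval-≈0 q y (sym ∘ p≈q))
eval-cong (c ∷ p) []      y p≈q = eval-≈0 (c ∷ p) y p≈q
eval-cong (c ∷ p) (d ∷ q) y p≈q =
  cong₂ (λ u v → u ℤ.+ y ℤ.* v) (p≈q 0) (eval-cong p q y (p≈q ∘ suc))

eval-+ : ∀ p q y → eval (p +ₚ q) y ≡ eval p y ℤ.+ eval q y
eval-+ []      q       y = sym (ℤ.+-identityˡ _)
eval-+ (c ∷ p) []      y = sym (ℤ.+-identityʳ _)
eval-+ (c ∷ p) (d ∷ q) y rewrite eval-+ p q y =
  solve 5 (λ c d y u v → c :+ d :+ y :* (u :+ v) := c :+ y :* u :+ (d :+ y :* v))
    refl c d y (eval p y) (eval q y)
  where open +-*-Solver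

eval-scale : ∀ c p y → eval (map (c ℤ.*_) p) y ≡ c ℤ.* eval p y
eval-scale c []      y = sym (ℤ.*-zeroʳ c)
eval-scale c (d ∷ p) y rewrite eval-scale c p y =
  solve 4 (λ c d y u → c :* d :+ y :* (c :* u) := c :* (d :+ y :* u))
    refl c d y (eval p y)
  where open +-*-Solver

eval-* : ∀ p q y → eval (p *ₚ q) y ≡ eval p y ℤ.* eval q y
eval-* []      q y = refl
eval-* (c ∷ p) q y
  rewrite eval-+ (map (c ℤ.*_) q) (ℤ.0ℤ ∷ (p *ₚ q)) y | eval-scale c q y | eval-* p q y =
  solve 4 (λ c y u v → c :* v :+ (con ℤ.0ℤ :+ y :* (u :* v)) := (c :+ y :* u) :* v)
    refl c y (eval p y) (eval q y)
  where open +-*-Solver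

eval-y- : ∀ a x → eval (y- a) (x ℤ.+ a) ≡ x
eval-y- a x =
  solve 2 (λ a x → :- a :+ (x :+ a) :* (con ℤ.1ℤ :+ (x :+ a) :* con ℤ.0ℤ) := x)
    refl a x
  where open +-*-Solver

-- At `y = x + a` the factor `y- a` takes the value `x`. One copy of it is split off the power; the
-- cofactor `q` stays arbitrary.
x∣eval : ∀ a e p q x → p ≈ₚ (y- a) ^ₚ suc e *ₚ q → x ∣ ∣ eval p (+ x ℤ.+ a) ∣
x∣eval a e p q x p≈ = subst (x ∣_) (sym ∣p∣≡) (∣m⇒∣m*n ∣ eval q y ∣ (m∣m*n ∣ u ∣))
  where
  y = + x ℤ.+ a
  u = eval ((y- a) ^ₚ e) y
  open ≡-Reasoning
  ∣p∣≡ : ∣ eval p y ∣ ≡ x * ∣ u ∣ * ∣ eval q y ∣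
  ∣p∣≡ = begin
    ∣ eval p y ∣                            ≡⟨ cong ∣_∣ (eval-cong p ((y- a) ^ₚ suc e *ₚ q) y p≈) ⟩
    ∣ eval ((y- a) ^ₚ suc e *ₚ q) y ∣       ≡⟨ cong ∣_∣ (eval-* ((y- a) ^ₚ suc e) q y) ⟩
    ∣ eval ((y- a) ^ₚ suc e) y ℤ.* eval q y ∣ ≡⟨ ℤ.abs-* (eval ((y- a) ^ₚ suc e) y) (eval q y) ⟩
    ∣ eval ((y- a) ^ₚ suc e) y ∣ * ∣ eval q y ∣
      ≡⟨ cong (λ v → ∣ v ∣ * ∣ eval q y ∣) (eval-* (y- a) ((y- a) ^ₚ e) y) ⟩
    ∣ eval (y- a) y ℤ.* u ∣ * ∣ eval q y ∣
      ≡⟨ cong (λ v → ∣ v ℤ.* u ∣ * ∣ eval q y ∣) (eval-y- a (+ x)) ⟩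
    ∣ + x ℤ.* u ∣ * ∣ eval q y ∣            ≡⟨ cong (_* ∣ eval q y ∣) (ℤ.abs-* (+ x) u) ⟩
    x * ∣ u ∣ * ∣ eval q y ∣                ∎

-- The `ℓ¹` norm of the coefficients, which adds up along the Horner recursion of `eval`.
height : Poly → ℕ
height []      = 0
height (c ∷ p) = ∣ c ∣ + height p

∣eval∣≤height*^ : ∀ p y M .{{_ : NonZero M}} → ∣ y ∣ ≤ M → ∣ eval p y ∣ ≤ height p * M ^ length p
∣eval∣≤height*^ []      y M y≤M = z≤n
∣eval∣≤height*^ (c ∷ p) y M y≤M = begin
  ∣ c ℤ.+ y ℤ.* eval p y ∣            ≤⟨ ℤ.∣i+j∣≤∣i∣+∣j∣ c _ ⟩
  ∣ c ∣ + ∣ y ℤ.* eval p y ∣          ≡⟨ cong (λ z → ∣ c ∣ + z) (ℤ.abs-* y _) ⟩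
  ∣ c ∣ + ∣ y ∣ * ∣ eval p y ∣
    ≤⟨ +-mono-≤ (m≤m*n ∣ c ∣ (M * M ^ l) {{m^n≢0 M (suc l)}})
                (*-mono-≤ y≤M (∣eval∣≤height*^ p y M y≤M)) ⟩
  ∣ c ∣ * (M * M ^ l) + M * (height p * M ^ l)
    ≡⟨ cong (λ z → ∣ c ∣ * (M * M ^ l) + z) (x∙yz≈y∙xz M (height p) _) ⟩
  ∣ c ∣ * (M * M ^ l) + height p * (M * M ^ l) ≡⟨ *-distribʳ-+ _ ∣ c ∣ _ ⟨
  (∣ c ∣ + height p) * (M * M ^ l)    ∎
  where
  open ≤-Reasoning
  l = length p

-- Since `x ≥ 1`, `x + ∣ a ∣` is at most `suc ∣ a ∣ * x`. In this multiplicative form an exponential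
-- bound on `x` carries over to the value of `p`.
∣eval∣≤ : ∀ p a x .{{_ : NonZero x}} → ∣ eval p (+ x ℤ.+ a) ∣ ≤ height p * (suc ∣ a ∣ * x) ^ length p
∣eval∣≤ p a x = ∣eval∣≤height*^ p _ (suc ∣ a ∣ * x) {{m*n≢0 (suc ∣ a ∣) x}}
  (≤-trans (ℤ.∣i+j∣≤∣i∣+∣j∣ (+ x) a) (+-monoʳ-≤ x (m≤m*n ∣ a ∣ x)))

-- Products of lists

module _ {P : ℕ → Set} (P? : Decidable P) where

  product-filter : ∀ ns → product ns ≡ product (filter P? ns) * product (filter (¬? ∘ P?) ns)
  product-filter []       = refl
  product-filter (n ∷ ns) with P? n
  ... | yes _ = trans (cong (n *_) (product-filter ns)) (sym (*-assoc n _ _))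
  ... | no  _ = trans (cong (n *_) (product-filter ns))
                      (x∙yz≈y∙xz n (product (filter P? ns)) _)

product-replicate : ∀ {q} ns → All (q ≡_) ns → product ns ≡ q ^ length ns
product-replicate []       []            = refl
product-replicate (n ∷ ns) (refl ∷ q≡ns) = cong (n *_) (product-replicate ns q≡ns)

-- Induction on `qs`: the copies of `q` in `ns` contribute at most `q ^ k`, and what remains has its
-- entries in the tail. It is applied with `qs` the distinct prime factors of a k-free number.
product≤product^ : ∀ k qs ns → All NonZero qs → All (_∈ qs) ns →
                   (∀ p → length (filter (p ≟_) ns) ≤ k) →
                   product ns ≤ product qs ^ k
product≤product^ k []       []       _            _ _ = ≤-reflexive (sym (^-zeroˡ k))
product≤product^ k []       (n ∷ ns) _            (() ∷ _) _
product≤product^ k (q ∷ qs) ns       (q≢0 ∷ qs≢0) ns⊆ count≤k = begin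
  product ns                         ≡⟨ product-filter (q ≟_) ns ⟩
  product (filter (q ≟_) ns) * product ns′
    ≡⟨ cong (_* product ns′) (product-replicate _ (All.all-filter (q ≟_) ns)) ⟩
  q ^ length (filter (q ≟_) ns) * product ns′
    ≤⟨ *-mono-≤ (^-monoʳ-≤ q {{q≢0}} (count≤k q))
                (product≤product^ k qs ns′ qs≢0 (All.tabulate ns′⊆) count′≤k) ⟩
  q ^ k * product qs ^ k             ≡⟨ ^-distribʳ-* k q (product qs) ⟨
  (q * product qs) ^ k               ∎
  where
  open ≤-Reasoning
  ns′ = filter (¬? ∘ (q ≟_)) ns
  ns′⊆ : ∀ {n} → n ∈ ns′ → n ∈ qs
  ns′⊆ n∈ns′ with ∈-filter⁻ (¬? ∘ (q ≟_)) {xs = ns} n∈ns′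
  ... | n∈ns , q≢n with All.lookup ns⊆ n∈ns
  ...   | here n≡q   = contradiction (sym n≡q) q≢n
  ...   | there n∈qs = n∈qs
  count′≤k : ∀ p → length (filter (p ≟_) ns′) ≤ k
  count′≤k p = ≤-trans
    (length-mono-≤ (filter⁺ (p ≟_) (p ≟_) (λ { refl p≡x → p≡x }) (filter-⊆ (¬? ∘ (q ≟_)) ns)))
    (count≤k p)

-- Divisibility by primes

prime∣prime⇒≡ : ∀ {p q} → Prime p → Prime q → p ∣ q → p ≡ q
prime∣prime⇒≡ p-prime q-prime p∣q with prime⇒irreducible q-prime p∣q
... | inj₁ refl = contradiction p-prime ¬prime[1]
... | inj₂ p≡q  = p≡q

-- Write `n = c * p` for the first prime `p`. Each later prime divides `c * p` and differs from `p`,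
-- so by Euclid's lemma it divides `c`.
productOfPrimes∣ : ∀ {ps n} → Unique ps → All Prime ps → All (_∣ n) ps → product ps ∣ n
productOfPrimes∣ {[]}     _             _                  _                       = 1∣ _
productOfPrimes∣ {p ∷ ps} (p∉ps ∷ uniq) (p-prime ∷ primes) (divides c refl ∷ ps∣n) =
  subst (p * product ps ∣_) (*-comm p c)
    (*-monoʳ-∣ p (productOfPrimes∣ uniq primes (All.tabulate ps∣c)))
  where
  ps∣c : ∀ {q} → q ∈ ps → q ∣ c
  ps∣c q∈ps with euclidsLemma c p (All.lookup primes q∈ps) (All.lookup ps∣n q∈ps)
  ... | inj₁ q∣c = q∣c
  ... | inj₂ q∣p = contradiction (sym (prime∣prime⇒≡ (All.lookup primes q∈ps) p-prime q∣p))
                                 (All.lookup p∉ps q∈ps)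

prime∣n!⇒≤n : ∀ {p} n → Prime p → p ∣ n ! → p ≤ n
prime∣n!⇒≤n zero    p-prime p∣1 with refl ← ∣1⇒≡1 p∣1 = contradiction p-prime ¬prime[1]
prime∣n!⇒≤n (suc n) p-prime p∣n! with euclidsLemma (suc n) (n !) p-prime p∣n!
... | inj₁ p∣1+n = ∣⇒≤ p∣1+n
... | inj₂ p∣n!′ = m≤n⇒m≤1+n (prime∣n!⇒≤n n p-prime p∣n!′)

prime∣^⇒∣ : ∀ {p} a n → Prime p → p ∣ a ^ n → p ∣ a
prime∣^⇒∣ a zero    p-prime p∣1 with refl ← ∣1⇒≡1 p∣1 = contradiction p-prime ¬prime[1]
prime∣^⇒∣ a (suc n) p-prime p∣a^n with euclidsLemma a (a ^ n) p-prime p∣a^n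
... | inj₁ p∣a    = p∣a
... | inj₂ p∣a^n′ = prime∣^⇒∣ a n p-prime p∣a^n′

prime∣product⇒∃∣ : ∀ {I : Set} {p} (f : I → ℕ) is → Prime p → p ∣ product (map f is) → ∃[ i ] p ∣ f i
prime∣product⇒∃∣ f []       p-prime p∣1 with refl ← ∣1⇒≡1 p∣1 = contradiction p-prime ¬prime[1]
prime∣product⇒∃∣ f (i ∷ is) p-prime p∣∏ with euclidsLemma (f i) _ p-prime p∣∏
... | inj₁ p∣fi = i , p∣fi
... | inj₂ p∣∏′ = prime∣product⇒∃∣ f is p-prime p∣∏′

-- Chebyshev's bound

-- By Pascal's rule, the bound doubles from each row to the next.
nCk≤2^n : ∀ n k → n C k ≤ 2 ^ n
nCk≤2^n zero    zero    = ≤-refl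
nCk≤2^n zero    (suc k) = z≤n
nCk≤2^n (suc n) zero    = m^n>0 2 (suc n)
nCk≤2^n (suc n) (suc k) = begin
  suc n C suc k          ≡⟨ nCk+nC[k+1]≡[n+1]C[k+1] n k ⟨
  n C k + n C suc k      ≤⟨ +-mono-≤ (nCk≤2^n n k) (nCk≤2^n n (suc k)) ⟩
  2 ^ n + 2 ^ n          ≡⟨ cong (λ z → 2 ^ n + z) (+-identityʳ _) ⟨
  2 ^ suc n              ∎
  where open ≤-Reasoning

n!≡nCk*k!*[n∸k]! : ∀ {n k} → k ≤ n → n ! ≡ (n C k) * (k ! * (n ∸ k) !)
n!≡nCk*k!*[n∸k]! {n} {k} k≤n = sym (trans
  (cong (_* (k ! * (n ∸ k) !)) (nCk≡n!/k![n-k]! k≤n))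
  (m/n*n≡m {{k !* (n ∸ k) !≢0}} (k![n∸k]!∣n! k≤n)))

-- Such a prime divides `(2 * m) !`, which is the binomial coefficient times `m !` twice, and it is
-- too large to divide `m !`.
prime∣[2m]Cm : ∀ {p} m → Prime p → m < p → p ≤ 2 * m → p ∣ (2 * m) C m
prime∣[2m]Cm {zero}  m p-prime m<p p≤2m = contradiction p-prime ¬prime[0]
prime∣[2m]Cm {suc p} m p-prime m<p p≤2m
  with euclidsLemma ((2 * m) C m) _ p-prime
         (subst (suc p ∣_) (n!≡nCk*k!*[n∸k]! (m≤m+n m (m + 0)))
           (∣-trans (m∣m*n (p !)) (m≤n⇒m!∣n! p≤2m)))
... | inj₁ p∣C = p∣C
... | inj₂ p∣m!m! = contradiction m<p (≤⇒≯ p≤m)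
  where
  p≤m : suc p ≤ m
  p≤m with euclidsLemma (m !) _ p-prime p∣m!m!
  ... | inj₁ p∣m! = prime∣n!⇒≤n m p-prime p∣m!
  ... | inj₂ p∣m! = prime∣n!⇒≤n m p-prime
    -- `2 * m` unfolds to `m + (m + 0)`, so the second factorial has to be rewritten into `m !`.
    (subst (λ n → suc p ∣ n !) (trans (m+n∸m≡n m (m + 0)) (+-identityʳ m)) p∣m!)

-- Induction on `j` with `m = 2 ^ j`: primes up to `m` fall under the induction hypothesis, and the
-- product of those between `m` and `2 * m` divides the central binomial coefficient, which is at
-- most `4 ^ m`. Powers of two make the halving exact.
primorial-2^ : ∀ j {ps} → Unique ps → All Prime ps → All (_≤ 2 ^ j) ps → product ps ≤ 4 ^ (2 ^ j)
primorial-2^ zero    {[]}             _ _ _ = s≤s z≤n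
primorial-2^ zero    {zero ∷ _}       _ (p-prime ∷ _) _ = contradiction p-prime ¬prime[0]
primorial-2^ zero    {suc zero ∷ _}   _ (p-prime ∷ _) _ = contradiction p-prime ¬prime[1]
primorial-2^ zero    {suc (suc _) ∷ _} _ _ (s≤s () ∷ _)
primorial-2^ (suc j) {ps} uniq primes ps≤ = begin
  product ps                     ≡⟨ product-filter (_≤? m) ps ⟩
  product small * product large
    ≤⟨ *-mono-≤
         (primorial-2^ j (Unique.filter⁺ (_≤? m) uniq) (All.filter⁺ (_≤? m) primes)
           (All.all-filter (_≤? m) ps))
         large≤ ⟩
  4 ^ m * 4 ^ m                  ≡⟨ ^-distribˡ-+-* 4 m m ⟨
  4 ^ (m + m)                    ≡⟨ cong (λ n → 4 ^ (m + n)) (+-identityʳ m) ⟨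
  4 ^ (2 * m)                    ∎
  where
  open ≤-Reasoning
  m = 2 ^ j
  small = filter (_≤? m) ps
  large = filter (¬? ∘ (_≤? m)) ps
  large∣ : product large ∣ (2 * m) C m
  large∣ = productOfPrimes∣ (Unique.filter⁺ _ uniq) (All.filter⁺ _ primes)
    (All.tabulate λ p∈large → let p∈ps , p≰m = ∈-filter⁻ (¬? ∘ (_≤? m)) {xs = ps} p∈large in
      prime∣[2m]Cm m (All.lookup primes p∈ps) (≰⇒> p≰m) (All.lookup ps≤ p∈ps))
  -- The coefficient is a factor of the nonzero `(2 * m) !`; without this a divisor need not be
  -- smaller.
  C≢0 : NonZero ((2 * m) C m)
  C≢0 = m*n≢0⇒m≢0 _ {{subst NonZero (n!≡nCk*k!*[n∸k]! (m≤m+n m (m + 0))) ((2 * m) !≢0)}}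
  large≤ : product large ≤ 4 ^ m
  large≤ = begin
    product large   ≤⟨ ∣⇒≤ {{C≢0}} large∣ ⟩
    (2 * m) C m     ≤⟨ nCk≤2^n (2 * m) m ⟩
    2 ^ (2 * m)     ≡⟨ ^-*-assoc 2 2 m ⟨
    4 ^ m           ∎

-- From `n` to `n + 1` the same power of two is kept while it is large enough and doubled otherwise.
∃2^∈[n,2n] : ∀ n .{{_ : NonZero n}} → ∃[ j ] n ≤ 2 ^ j × 2 ^ j ≤ 2 * n
∃2^∈[n,2n] (suc zero)    = 0 , s≤s z≤n , s≤s z≤n
∃2^∈[n,2n] (suc (suc n)) with ∃2^∈[n,2n] (suc n)
... | j , n≤2^j , 2^j≤2n with suc (suc n) ≤? 2 ^ j
...   | yes 1+n≤2^j = j , 1+n≤2^j , ≤-trans 2^j≤2n (*-monoʳ-≤ 2 (n≤1+n (suc n)))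
...   | no  1+n≰2^j = suc j
  , ≤-trans (s≤s (s≤s (m≤m+n n (n + 0)))) (≤-trans (≤-reflexive (cong suc (sym (+-suc n _)))) (*-monoʳ-≤ 2 n≤2^j))
  , *-monoʳ-≤ 2 (<⇒≤ (≰⇒> 1+n≰2^j))

-- Rounding `n` up to a power of two costs at most a factor 2 in the exponent, which turns base 4
-- into base 16.
primorial : ∀ n {ps} → Unique ps → All Prime ps → All (_≤ n) ps → product ps ≤ 16 ^ n
-- No power of two is at most `2 * 0`, so `n = 0` is separate: the list of primes must be empty.
primorial zero    {[]}    _ _             _           = s≤s z≤n
primorial zero    {_ ∷ _} _ (p-prime ∷ _) (z≤n ∷ _)   = contradiction p-prime ¬prime[0]
primorial (suc n) {ps}    uniq primes ps≤n with ∃2^∈[n,2n] (suc n)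
... | j , n≤2^j , 2^j≤2n = begin
  product ps         ≤⟨ primorial-2^ j uniq primes (All.map (λ p≤n → ≤-trans p≤n n≤2^j) ps≤n) ⟩
  4 ^ (2 ^ j)        ≤⟨ ^-monoʳ-≤ 4 2^j≤2n ⟩
  4 ^ (2 * suc n)    ≡⟨ ^-*-assoc 4 2 (suc n) ⟨
  16 ^ suc n         ∎
  where open ≤-Reasoning

-- Size of k-free numbers

exponent≤K : ∀ p x .{{_ : NonZero x}} → exponent p x ≤ K x
exponent≤K p x with any? (p ≟_) (factors (factorise x))
... | yes p∈ = All.lookup (xs≤max 0 _) (∈-map⁺ (λ q → exponent q x) p∈)
-- `K x` ranges only over primes that occur in `x`; any other `p` has exponent 0.
... | no  p∉ rewrite filter-none (p ≟_) (All.¬Any⇒All¬ _ p∉) = z≤n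

-- Every multiplicity is below `k`, so `x` is at most the k-th power of its radical, to which
-- `primorial` applies. The base `16 ^ k` does not depend on `n`.
kfree-bound : ∀ k x n → 𝓕 k x → (∀ {p} → Prime p → p ∣ x → p ≤ n) → x ≤ (16 ^ k) ^ n
kfree-bound k x n (x≢0 , K<k) p≤n = begin
  x                  ≡⟨ isFactorisation f ⟩
  product ps
    ≤⟨ product≤product^ k rad ps (All.map prime⇒nonZero rad-primes) (All.tabulate (∈-deduplicate⁺ _≟_))
         (λ p → ≤-trans (exponent≤K p x {{x≢0}}) (<⇒≤ K<k)) ⟩
  product rad ^ k
    ≤⟨ ^-monoˡ-≤ k (primorial n (Unique.deduplicate-! _≟_ ps) rad-primes
         (All.deduplicate⁺ _≟_ (All.tabulate λ p∈ps → p≤n (All.lookup (factorsPrime f) p∈ps)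
           (subst (_ ∣_) (sym (isFactorisation f)) (∈⇒∣product p∈ps))))) ⟩
  (16 ^ n) ^ k       ≡⟨ ^-*-assoc 16 n k ⟩
  16 ^ (n * k)       ≡⟨ cong (16 ^_) (*-comm n k) ⟩
  16 ^ (k * n)       ≡⟨ ^-*-assoc 16 k n ⟨
  (16 ^ k) ^ n       ∎
  where
  open ≤-Reasoning
  f = factorise x {{x≢0}}
  ps = factors f
  rad = deduplicate _≟_ ps
  rad-primes : All Prime rad
  rad-primes = All.deduplicate⁺ _≟_ (factorsPrime f)

-- Double factorials

-- This lets both kinds of factors be treated alike: primes dividing `n !!` divide `n !`, and `n !!`
-- is a common lower bound.
n!!∣n! : ∀ n → n !! ∣ n !
n!!∣n! zero          = ∣-refl
n!!∣n! (suc zero)    = ∣-refl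
n!!∣n! (suc (suc n)) = *-monoʳ-∣ (suc (suc n)) (∣n⇒∣m*n (suc n) (n!!∣n! n))

_!!≢0 : ∀ n → NonZero (n !!)
zero        !!≢0 = nonZero
suc zero    !!≢0 = nonZero
suc (suc n) !!≢0 = m*n≢0 (suc (suc n)) (n !!) {{nonZero}} {{n !!≢0}}

-- From `n` to `n + 2` the power gains `B * B` and the double factorial gains `n + 2`, which is the
-- larger once `n + 2 > B * B`. Up to that point `B ^ (B * B)` alone suffices.
B^n≤n!!*B^[B*B] : ∀ B .{{_ : NonZero B}} n → B ^ n ≤ n !! * B ^ (B * B)
B^n≤n!!*B^[B*B] B zero       = ≤-trans (m^n>0 B (B * B)) (≤-reflexive (sym (+-identityʳ _)))
B^n≤n!!*B^[B*B] B (suc zero) = ≤-trans (^-monoʳ-≤ B (1≤B*B B)) (≤-reflexive (sym (+-identityʳ _)))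
  where
  1≤B*B : ∀ B .{{_ : NonZero B}} → 1 ≤ B * B
  1≤B*B (suc _) = s≤s z≤n
B^n≤n!!*B^[B*B] B (suc (suc n)) with suc (suc n) ≤? B * B
... | yes 2+n≤B² = ≤-trans (^-monoʳ-≤ B 2+n≤B²) (m≤n*m _ (suc (suc n) !!) {{suc (suc n) !!≢0}})
... | no  2+n≰B² = begin
  B * (B * B ^ n)                          ≡⟨ *-assoc B B _ ⟨
  B * B * B ^ n                            ≤⟨ *-mono-≤ (<⇒≤ (≰⇒> 2+n≰B²)) (B^n≤n!!*B^[B*B] B n) ⟩
  suc (suc n) * (n !! * B ^ (B * B))       ≡⟨ *-assoc (suc (suc n)) (n !!) _ ⟨
  suc (suc n) !! * B ^ (B * B)             ∎
  where open ≤-Reasoning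

!!-bound : ℕ → ℕ → ℕ
!!-bound D c = D * (2 * c) ^ (2 * c * (2 * c))

n<2^n : ∀ n → n < 2 ^ n
n<2^n zero    = s≤s z≤n
n<2^n (suc n) = +-mono-≤ (m^n>0 2 n) (≤-trans (n<2^n n) (≤-reflexive (sym (+-identityʳ _))))

-- The previous estimate is used with base `2 * c` instead of `c`: cancelling `c ^ n` then leaves
-- `2 ^ n` bounded by a constant, and `n < 2 ^ n`.
!!≤D*c^n⇒n<!!-bound : ∀ D c .{{_ : NonZero c}} n → n !! ≤ D * c ^ n → n < !!-bound D c
!!≤D*c^n⇒n<!!-bound D c n n!!≤ = <-≤-trans (n<2^n n) (*-cancelʳ-≤ (2 ^ n) _ (c ^ n) {{m^n≢0 c n}} (begin
  2 ^ n * c ^ n           ≡⟨ ^-distribʳ-* n 2 c ⟨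
  (2 * c) ^ n             ≤⟨ B^n≤n!!*B^[B*B] (2 * c) {{m*n≢0 2 c}} n ⟩
  n !! * E                ≤⟨ *-monoˡ-≤ E n!!≤ ⟩
  D * c ^ n * E           ≡⟨ *-assoc D _ _ ⟩
  D * (c ^ n * E)         ≡⟨ cong (D *_) (*-comm _ E) ⟩
  D * (E * c ^ n)         ≡⟨ *-assoc D E _ ⟨
  D * E * c ^ n           ∎))
  where
  open ≤-Reasoning
  E = (2 * c) ^ (2 * c * (2 * c))

-- The right-hand side of the equation

module _ {r} (s : ℕ) (A : Fin r → ℕ) (n : Vec ℕ r) where

  private
    f g : Fin r → ℕ
    f i = A i ^ lookup n i * lookup n i !
    g i = A i ^ lookup n i * lookup n i !!
    is js : List (Fin r)
    is = filter (λ i → toℕ i <? s) (allFin r)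
    js = filter (λ i → s ≤? toℕ i) (allFin r)

  factorialProduct≢0 : (∀ i → 1 ≤ A i) → NonZero (factorialProduct s A n)
  factorialProduct≢0 A≥1 = m*n≢0 _ _
    {{product≢0 (All.map⁺ (All.universal (λ i → m*n≢0 _ _ {{A^≢0 i}} {{lookup n i !≢0}}) is))}}
    {{product≢0 (All.map⁺ (All.universal (λ i → m*n≢0 _ _ {{A^≢0 i}} {{lookup n i !!≢0}}) js))}}
    where
    A^≢0 : ∀ i → NonZero (A i ^ lookup n i)
    A^≢0 i = m^n≢0 (A i) (lookup n i) {{>-nonZero (A≥1 i)}}

  !!∣factorialProduct : ∀ i → lookup n i !! ∣ factorialProduct s A n
  !!∣factorialProduct i with toℕ i <? s
  ... | yes i<s = ∣m⇒∣m*n _ (∣-trans (∣n⇒∣m*n (A i ^ lookup n i) (n!!∣n! (lookup n i)))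
                    (∈⇒∣product (∈-map⁺ f (∈-filter⁺ _ (∈-allFin i) i<s))))
  ... | no  i≮s = ∣n⇒∣m*n (product (map f is)) (∣-trans (∣n⇒∣m*n (A i ^ lookup n i) ∣-refl)
                    (∈⇒∣product (∈-map⁺ g (∈-filter⁺ _ (∈-allFin i) (≮⇒≥ i≮s)))))

  -- In either case `p` is at most the largest `nᵢ` plus the largest `Aᵢ`, which limits the primes
  -- of any divisor of the right-hand side.
  prime∣factorialProduct : ∀ {p} → Prime p → p ∣ factorialProduct s A n →
                           ∃[ i ] (p ∣ A i ⊎ p ≤ lookup n i)
  prime∣factorialProduct {p} p-prime p∣N with euclidsLemma (product (map f is)) _ p-prime p∣N
  ... | inj₁ p∣∏f = let i , p∣fi = prime∣product⇒∃∣ f is p-prime p∣∏f in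
    i , Sum.map (prime∣^⇒∣ (A i) (lookup n i) p-prime) (prime∣n!⇒≤n (lookup n i) p-prime)
          (euclidsLemma (A i ^ lookup n i) _ p-prime p∣fi)
  ... | inj₂ p∣∏g = let i , p∣gi = prime∣product⇒∃∣ g js p-prime p∣∏g in
    i , Sum.map (prime∣^⇒∣ (A i) (lookup n i) p-prime)
          (λ p∣n!! → prime∣n!⇒≤n (lookup n i) p-prime (∣-trans p∣n!! (n!!∣n! (lookup n i))))
          (euclidsLemma (A i ^ lookup n i) _ p-prime p∣gi)

-- The finite box of candidate solutions

vecsBelow : ℕ → ∀ r → List (Vec ℕ r)
vecsBelow w zero    = [] ∷ []
vecsBelow w (suc r) = cartesianProductWith _∷_ (upTo w) (vecsBelow w r)

∈-vecsBelow : ∀ w {r} (v : Vec ℕ r) → (∀ i → lookup v i < w) → v ∈ vecsBelow w r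
∈-vecsBelow w []      v<w = here refl
∈-vecsBelow w (n ∷ v) v<w =
  ∈-cartesianProductWith⁺ _∷_ (∈-upTo⁺ (v<w Fin.zero)) (∈-vecsBelow w v (v<w ∘ Fin.suc))

theorem4 : (k : ℕ) → 2 ≤ k →
    (a : ℤ) →
    (s r : ℕ) → s ≤ r → 1 ≤ r →
    (A : Fin r → ℕ) → (∀ i → 1 ≤ A i) →
    (e : ℕ) → 1 ≤ e →
    (t : ℕ) (Pⱼ : Fin t → Poly) (eⱼ : Fin t → ℕ) →
    (∀ j → 1 ≤ eⱼ j) →
    (∀ j → Irreducible (Pⱼ j)) →
    (∀ i j → i ≢ j → ¬ (Pⱼ i ≈ₚ Pⱼ j)) →
    (P : Poly) → P ≈ₚ (y- a) ^ₚ e *ₚ ∏ₚ (λ j → Pⱼ j ^ₚ eⱼ j) →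
    ∃[ L ] (∀ (n : Vec ℕ r) (y : ℤ) →
    (∀ i → 1 ≤ lookup n i) →
    (∃[ x ] (𝓕 k x × y ≡ + x ℤ.+ a)) →
    eval P y ≡ + factorialProduct s A n →
    (n , y) ∈ L)
theorem4 k _ a s r@(suc _) _ _ A A≥1 (suc e) _ t Pⱼ eⱼ _ _ _ P P≈ =
  -- The box consists of all `n` with entries below `w` and all `x` up to `b ^ (w + R)`; the `suc`
  -- is there because `upTo` excludes its endpoint.
  cartesianProduct (vecsBelow w r) (map (λ x → + x ℤ.+ a) (upTo (suc (b ^ (w + R))))) , ∈L
  where
  b d R q w : ℕ
  b = 16 ^ k
  d = length P
  R = max 0 (map A (allFin r))
  -- The part of `height P * (suc ∣ a ∣ * b ^ (m + R)) ^ d` that is free of `m`; the other part is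
  -- `(b ^ d) ^ m`.
  q = height P * (suc ∣ a ∣ * b ^ R) ^ d
  w = !!-bound q (b ^ d)

  b≢0 : NonZero b
  b≢0 = m^n≢0 16 k

  A≤R : ∀ i → A i ≤ R
  A≤R i = All.lookup (xs≤max 0 _) (∈-map⁺ A (∈-allFin i))

  ∈L : ∀ n y → (∀ i → 1 ≤ lookup n i) → (∃[ x ] (𝓕 k x × y ≡ + x ℤ.+ a)) →
       eval P y ≡ + factorialProduct s A n → (n , y) ∈ _
  ∈L n y _ (x , x∈𝓕@(x≢0 , _) , refl) P≡N =
    ∈-cartesianProduct⁺ (∈-vecsBelow w n (λ i → ≤-<-trans (n≤m i) m<w))
      (∈-map⁺ _ (∈-upTo⁺ (s≤s (≤-trans x≤ (^-monoʳ-≤ b {{b≢0}} (+-monoˡ-≤ R (<⇒≤ m<w)))))))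
    where
    i₀ : Fin r
    -- An index attaining the maximum is kept, since `m !!` must be a divisor of `N`. `Fin.zero`
    -- exists because `r ≥ 1`.
    i₀ = argmax (lookup n) Fin.zero (allFin r)
    m N : ℕ
    m = lookup n i₀
    N = factorialProduct s A n

    n≤m : ∀ i → lookup n i ≤ m
    n≤m i = All.lookup (f[xs]≤f[argmax] {f = lookup n} Fin.zero (allFin r)) (∈-allFin i)

    x∣N : x ∣ N
    x∣N = subst (λ z → x ∣ ∣ z ∣) P≡N (x∣eval a e P _ x P≈)

    p≤m+R : ∀ {p} → Prime p → p ∣ x → p ≤ m + R
    p≤m+R p-prime p∣x with prime∣factorialProduct s A n p-prime (∣-trans p∣x x∣N)
    ... | i , inj₁ p∣Aᵢ = ≤-trans (∣⇒≤ {{>-nonZero (A≥1 i)}} p∣Aᵢ) (≤-trans (A≤R i) (m≤n+m R m))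
    ... | i , inj₂ p≤nᵢ = ≤-trans p≤nᵢ (≤-trans (n≤m i) (m≤m+n m R))

    x≤ : x ≤ b ^ (m + R)
    x≤ = kfree-bound k x (m + R) x∈𝓕 p≤m+R

    open ≤-Reasoning
    m!!≤ : m !! ≤ q * (b ^ d) ^ m
    m!!≤ = begin
      m !!                                    ≤⟨ ∣⇒≤ {{factorialProduct≢0 s A n A≥1}} (!!∣factorialProduct s A n i₀) ⟩
      N                                       ≡⟨ cong ∣_∣ P≡N ⟨
      ∣ eval P (+ x ℤ.+ a) ∣                  ≤⟨ ∣eval∣≤ P a x {{x≢0}} ⟩
      height P * (suc ∣ a ∣ * x) ^ d          ≤⟨ *-monoʳ-≤ (height P) (^-monoˡ-≤ d (*-monoʳ-≤ (suc ∣ a ∣) x≤)) ⟩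
      height P * (suc ∣ a ∣ * b ^ (m + R)) ^ d
        ≡⟨ cong (λ z → height P * (suc ∣ a ∣ * z) ^ d) (trans (^-distribˡ-+-* b m R) (*-comm (b ^ m) _)) ⟩
      height P * (suc ∣ a ∣ * (b ^ R * b ^ m)) ^ d
        ≡⟨ cong (λ z → height P * z ^ d) (*-assoc (suc ∣ a ∣) (b ^ R) (b ^ m)) ⟨
      height P * (suc ∣ a ∣ * b ^ R * b ^ m) ^ d
        ≡⟨ cong (height P *_) (^-distribʳ-* d (suc ∣ a ∣ * b ^ R) _) ⟩
      height P * ((suc ∣ a ∣ * b ^ R) ^ d * (b ^ m) ^ d) ≡⟨ *-assoc (height P) _ _ ⟨
      q * (b ^ m) ^ d                         ≡⟨ cong (q *_) (^-*-assoc b m d) ⟩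
      q * b ^ (m * d)                         ≡⟨ cong (λ z → q * b ^ z) (*-comm m d) ⟩
      q * b ^ (d * m)                         ≡⟨ cong (q *_) (^-*-assoc b d m) ⟨
      q * (b ^ d) ^ m                         ∎

    m<w : m < w
    m<w = !!≤D*c^n⇒n<!!-bound q (b ^ d) {{m^n≢0 b d {{b≢0}}}} m m!!≤
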